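{- Let $r$ and $d$ be positive integers. Suppose that $G$ is a graph on $n>\frac{27}{8}dr^2$ vertices, having maximum degree less than $d$. Then $G$ is $r$-EKR.
   Context: All graphs are finite and simple. For a graph $G$, $\mathcal{I}^r(G)$ denotes the family of independent sets of $G$ of size exactly $r$, and for a vertex $v$, $s_r(v)$ denotes the number of members of $\mathcal{I}^r(G)$ containing $v$. A family of sets is intersecting if every two of its members intersect. $G$ is called $r$-EKR if, letting $\mathcal{F}\subseteq \mathcal{I}^r(G)$ be an intersecting subfamily of maximum size, some vertex $v$ satisfies $s_r(v)=|\mathcal{F}|$ (i.e. the maximum size of an intersecting subfamily of $\mathcal{I}^r(G)$ is attained by the family of all independent $r$-sets containing some fixed vertex). -}

module Defs where

open import Data.Nat using (ℕ; zero; suc; _+_; _*_; _<_; _≤_)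
open import Data.Bool using (Bool; true; false; _∧_; if_then_else_)
open import Data.Fin using (Fin)
open import Data.Fin.Subset using (Subset; _∈_; _∩_; ∣_∣; Nonempty; inside; outside)
open import Data.Vec using (Vec; []; _∷_; lookup; count)
open import Data.List using (List; []; _∷_; _++_; map; length; filter)
import Data.List.Membership.Propositional as LM
open import Data.List.Relation.Unary.Unique.Propositional using (Unique)
open import Data.Product using (_×_)
open import Relation.Binary.PropositionalEquality using (_≡_)
open import Relation.Nullary using (Dec; yes; no)
open import Relation.Nullary.Decidable using (⌊_⌋)
open import Data.Bool using (T)

record Graph (n : ℕ) : Set where
  field
    adj   : Fin n → Fin n → Bool
    sym   : ∀ i j → adj i j ≡ adj j i
    irrefl : ∀ i → adj i i ≡ false
open Graph public

degree : ∀ {n} → Graph n → Fin n → ℕ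
degree {n} G v = count (λ u → T? (adj G v u)) (Data.Vec.tabulate (λ u → u))
  where
  T? : (b : Bool) → Dec (T b)
  T? true  = yes _
  T? false = no (λ ())

Independent : ∀ {n} → Graph n → Subset n → Set
Independent G S = ∀ i j → i ∈ S → j ∈ S → adj G i j ≡ false

IndepOfSize : ∀ {n} → Graph n → ℕ → Subset n → Set
IndepOfSize G r S = Independent G S × ∣ S ∣ ≡ r

allSubsets : (n : ℕ) → List (Subset n)
allSubsets zero    = [] ∷ []
allSubsets (suc n) = map (outside ∷_) (allSubsets n) ++ map (inside ∷_) (allSubsets n)

isIndepContaining : ∀ {n} → Graph n → ℕ → Fin n → Subset n → Bool
isIndepContaining {n} G r v S =
  lookup S v ∧ (⌊ ∣ S ∣ Data.Nat.≟ r ⌋ ∧ indepB)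
  where
  open import Data.Bool.ListAction using (all)
  vs : List (Fin n)
  vs = Data.List.allFin n
  indepB : Bool
  indepB = all (λ i → all (λ j → if lookup S i ∧ lookup S j then Data.Bool.not (adj G i j) else true) vs) vs

s : ∀ {n} → Graph n → ℕ → Fin n → ℕ
s G r v = length (filter (λ S → Data.Bool._≟_ (isIndepContaining G r v S) true) (allSubsets _))

IntersectingFamily : ∀ {n} → Graph n → ℕ → List (Subset n) → Set
IntersectingFamily G r F =
  Unique F
  × (∀ {S} → S LM.∈ F → IndepOfSize G r S)
  × (∀ {S T} → S LM.∈ F → T LM.∈ F → Nonempty (S ∩ T))

EKR : ∀ {n} → Graph n → ℕ → Set
EKR {n} G r =
  ∀ F → IntersectingFamily G r F
      → (∀ F′ → IntersectingFamily G r F′ → length F′ ≤ length F)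
      → Data.Product.∃ λ (v : Fin n) → s G r v ≡ length F

module Submission where

-- Let T be a smallest set meeting every member of F, and t = |T|. A set X with
-- |X| < t misses some member S of F, so every member of F containing X contains
-- X ∪ {y} for one of the r elements y of S. On the other hand, exchanging y for
-- one of the n − rd ≥ 2r² vertices outside the closed neighbourhood of an
-- independent set shows that at most a fraction 1/(2r) of the independent r-sets
-- containing X contain X ∪ {y}. Descending from size t to size 1, the members of
-- F containing a vertex x number at most s(x) / 2^(t−1), hence |F| is at most
-- t / 2^(t−1) ≤ 1 times the largest s(x).

open import Defs hiding (sym)
open import Data.Nat using (ℕ; zero; suc; _+_; _*_; _<_; _≤_; _^_; z≤n; s≤s; NonZero; >-nonZero)
import Data.Nat as ℕ
open import Data.Nat.Properties
open import Data.Nat.Tactic.RingSolver using (solve-∀)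
open import Data.Bool using (Bool; true; false; T; _∧_; not; if_then_else_)
import Data.Bool as Bool
open import Data.Bool.ListAction using (all)
open import Data.Bool.Properties using (T-∧; T-≡; ¬-not)
open import Data.Fin using (Fin; zero; suc)
import Data.Fin.Properties as Fin
open import Data.Fin.Subset using (Subset; inside; outside; _∈_; _∉_; _⊆_; _∩_; _∪_; ⁅_⁆; ∣_∣; Nonempty; ⊥)
open import Data.Fin.Subset.Properties
open import Data.List using (List; []; _∷_; _++_; map; length; filter; concatMap; allFin)
import Data.List as List
open import Data.List.Extrema.Nat using (argmin; argmin-all; f[argmin]≤f[xs]; argmax; f[xs]≤f[argmax])
import Data.List.Membership.DecPropositional as DecMembership
import Data.List.Membership.Propositional as LM
open import Data.List.Membership.Propositional using (find; lose)
open import Data.List.Membership.Propositional.Properties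
open import Data.List.Properties using (length-map; length-++; filter-all; length-tabulate)
open import Data.List.Relation.Unary.All using (All; []; _∷_)
import Data.List.Relation.Unary.All as All
import Data.List.Relation.Unary.All.Properties as All
open import Data.List.Relation.Unary.AllPairs using ([]; _∷_)
open import Data.List.Relation.Unary.Any using (here; there)
open import Data.List.Relation.Unary.Unique.Propositional using (Unique)
import Data.List.Relation.Unary.Unique.Propositional.Properties as Unique
open import Data.Product using (∃; _×_; _,_; proj₁; proj₂)
open import Data.Sum using (_⊎_; inj₁; inj₂)
open import Data.Vec using ([]; _∷_; lookup; _[_]≔_; here; there)
import Data.Vec as Vec
open import Data.Vec.Properties using ([]=⇒lookup; lookup⇒[]=; []≔-idempotent; ∷-injectiveʳ)
open import Function using (_∘_; id)
open import Function.Bundles using (Equivalence)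
open import Relation.Binary.PropositionalEquality using (_≡_; _≢_; refl; sym; trans; cong; subst; module ≡-Reasoning)
open import Relation.Nullary using (¬_; yes; no; contradiction)
open import Relation.Nullary.Decidable using (⌊_⌋; _×-dec_; _→-dec_; ¬?; fromWitness; toWitness)
open import Relation.Unary using (Decidable)

-- Counting in lists

module _ {A B : Set} (f : A → B) where

  -- By induction on `xs`: one occurrence of `f x` is cut out of `ys`, and injectivity keeps the
  -- images of the remaining entries inside what is left.
  length-injection : {xs : List A} {ys : List B} → Unique xs →
    (∀ {x} → x LM.∈ xs → f x LM.∈ ys) →
    (∀ {x y} → x LM.∈ xs → y LM.∈ xs → f x ≡ f y → x ≡ y) →
    length xs ≤ length ys
  length-injection [] _ _ = z≤n
  length-injection {x ∷ xs} (x≢ ∷ u) f∈ inj with ∈-∃++ (f∈ (here refl))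
  ... | as , bs , refl = begin
    suc (length xs)               ≤⟨ s≤s (length-injection u f∈′ (λ p q → inj (there p) (there q))) ⟩
    suc (length (as ++ bs))       ≡⟨ cong suc (length-++ as) ⟩
    suc (length as + length bs)   ≡⟨ +-suc (length as) (length bs) ⟨
    length as + suc (length bs)   ≡⟨ length-++ as ⟨
    length (as ++ f x ∷ bs)       ∎
    where
    open ≤-Reasoning
    f∈′ : ∀ {y} → y LM.∈ xs → f y LM.∈ as ++ bs
    f∈′ {y} y∈ with ∈-++⁻ as (f∈ (there y∈))
    ... | inj₁ p           = ∈-++⁺ˡ p
    ... | inj₂ (there p)   = ∈-++⁺ʳ as p
    ... | inj₂ (here fy≡)  =
      contradiction (inj (here refl) (there y∈) (sym fy≡)) (All.lookup x≢ y∈)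

length-⊆ : {A : Set} {xs ys : List A} → Unique xs → (∀ {x} → x LM.∈ xs → x LM.∈ ys) →
  length xs ≤ length ys
length-⊆ u xs⊆ys = length-injection id u xs⊆ys (λ _ _ → id)

module _ {A B : Set} (f : A → List B) where

  -- The factor `a` expresses a bound of `b / a` per entry without division; later `a` is a power of
  -- two, possibly times `2 * r`, or just 1.
  length-concatMap-≤ : ∀ a b xs → (∀ {x} → x LM.∈ xs → length (f x) * a ≤ b) →
    length (concatMap f xs) * a ≤ length xs * b
  length-concatMap-≤ a b []       _ = z≤n
  length-concatMap-≤ a b (x ∷ xs) h = begin
    length (f x ++ concatMap f xs) * a               ≡⟨ cong (_* a) (length-++ (f x)) ⟩
    (length (f x) + length (concatMap f xs)) * a     ≡⟨ *-distribʳ-+ a (length (f x)) _ ⟩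
    length (f x) * a + length (concatMap f xs) * a   ≤⟨ +-mono-≤ (h (here refl)) (length-concatMap-≤ a b xs (h ∘ there)) ⟩
    b + length xs * b                                ∎
    where open ≤-Reasoning

  length-concatMap-≥ : ∀ b xs → (∀ {x} → x LM.∈ xs → b ≤ length (f x)) →
    length xs * b ≤ length (concatMap f xs)
  length-concatMap-≥ b []       _ = z≤n
  length-concatMap-≥ b (x ∷ xs) h = begin
    b + length xs * b                       ≤⟨ +-mono-≤ (h (here refl)) (length-concatMap-≥ b xs (h ∘ there)) ⟩
    length (f x) + length (concatMap f xs)  ≡⟨ length-++ (f x) ⟨
    length (f x ++ concatMap f xs)          ∎
    where open ≤-Reasoning

  -- Incidence pairs for double counting: `exchange` compares two such lists, fibre by fibre.
  graph : List A → List (A × B)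
  graph = concatMap (λ x → map (x ,_) (f x))

  ∈-graph⁺ : ∀ {x y xs} → x LM.∈ xs → y LM.∈ f x → (x , y) LM.∈ graph xs
  ∈-graph⁺ x∈ y∈ = ∈-concatMap⁺ _ (lose x∈ (∈-map⁺ _ y∈))

  ∈-graph⁻ : ∀ {x y} xs → (x , y) LM.∈ graph xs → x LM.∈ xs × y LM.∈ f x
  ∈-graph⁻ xs p with find (∈-concatMap⁻ _ {xs} p)
  ... | _ , x∈ , q with ∈-map⁻ _ q
  ... | _ , y∈ , refl = x∈ , y∈

  graph-unique : ∀ {xs} → Unique xs → (∀ x → Unique (f x)) → Unique (graph xs)
  graph-unique [] _ = []
  graph-unique {x ∷ xs} (x≢ ∷ u) v =
    Unique.++⁺ (Unique.map⁺ (λ { refl → refl }) (v x)) (graph-unique u v) disjoint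
    where
    disjoint : ∀ {p} → ¬ (p LM.∈ map (x ,_) (f x) × p LM.∈ graph xs)
    disjoint (p , q) with ∈-map⁻ _ p
    ... | _ , _ , refl = All.lookup x≢ (proj₁ (∈-graph⁻ xs q)) refl

count-tabulate : ∀ {n} {A : Set} {P : A → Set} (P? : Decidable P) (f : Fin n → A) →
  Vec.count P? (Vec.tabulate f) ≡ length (filter P? (List.tabulate f))
count-tabulate {zero}  P? f = refl
count-tabulate {suc n} P? f with P? (f zero)
... | yes _ = cong suc (count-tabulate P? (f ∘ suc))
... | no  _ = count-tabulate P? (f ∘ suc)

-- Carries list counts over to `degree`, which counts along a vector. `P?` is arbitrary because the
-- decision procedure of `degree` is local to it.
length-≤-count : ∀ {n} {P : Fin n → Set} (P? : Decidable P) {xs : List (Fin n)} → Unique xs →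
  (∀ {x} → x LM.∈ xs → P x) → length xs ≤ Vec.count P? (Vec.tabulate id)
length-≤-count {n} P? {xs} u h = begin
  length xs                          ≤⟨ length-⊆ u (λ {x} x∈ → ∈-filter⁺ P? (∈-allFin x) (h x∈)) ⟩
  length (filter P? (allFin n))      ≡⟨ count-tabulate P? id ⟨
  Vec.count P? (Vec.tabulate id)     ∎
  where open ≤-Reasoning

-- Subsets

allSubsets-complete : ∀ {n} (S : Subset n) → S LM.∈ allSubsets n
allSubsets-complete []            = here refl
allSubsets-complete (outside ∷ S) = ∈-++⁺ˡ (∈-map⁺ _ (allSubsets-complete S))
allSubsets-complete (inside ∷ S)  = ∈-++⁺ʳ (map (outside ∷_) (allSubsets _)) (∈-map⁺ _ (allSubsets-complete S))

allSubsets-unique : ∀ n → Unique (allSubsets n)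
allSubsets-unique zero    = [] ∷ []
allSubsets-unique (suc n) =
  Unique.++⁺ (Unique.map⁺ ∷-injectiveʳ (allSubsets-unique n))
             (Unique.map⁺ ∷-injectiveʳ (allSubsets-unique n)) disjoint
  where
  disjoint : ∀ {S} → ¬ (S LM.∈ map (outside ∷_) (allSubsets n) × S LM.∈ map (inside ∷_) (allSubsets n))
  disjoint (p , q) with ∈-map⁻ _ p | ∈-map⁻ _ q
  ... | _ , _ , refl | _ , _ , ()

elements : ∀ {n} → Subset n → List (Fin n)
elements []            = []
elements (inside ∷ S)  = zero ∷ map suc (elements S)
elements (outside ∷ S) = map suc (elements S)

length-elements : ∀ {n} (S : Subset n) → length (elements S) ≡ ∣ S ∣
length-elements []            = refl
length-elements (inside ∷ S)  = cong suc (trans (length-map suc (elements S)) (length-elements S))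
length-elements (outside ∷ S) = trans (length-map suc (elements S)) (length-elements S)

∈-elements⁺ : ∀ {n} {S : Subset n} {x} → x ∈ S → x LM.∈ elements S
∈-elements⁺ here                            = here refl
∈-elements⁺ {S = inside ∷ _}  (there x∈S)   = there (∈-map⁺ suc (∈-elements⁺ x∈S))
∈-elements⁺ {S = outside ∷ _} (there x∈S)   = ∈-map⁺ suc (∈-elements⁺ x∈S)

∈-elements⁻ : ∀ {n} (S : Subset n) {x} → x LM.∈ elements S → x ∈ S
∈-elements⁻ (inside ∷ S)  (here refl) = here
∈-elements⁻ (inside ∷ S)  (there p) with ∈-map⁻ suc p
... | _ , q , refl = there (∈-elements⁻ S q)
∈-elements⁻ (outside ∷ S) p with ∈-map⁻ suc p
... | _ , q , refl = there (∈-elements⁻ S q)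

∣p∪⁅x⁆∣≤1+∣p∣ : ∀ {n} (p : Subset n) x → ∣ p ∪ ⁅ x ⁆ ∣ ≤ suc ∣ p ∣
∣p∪⁅x⁆∣≤1+∣p∣ (inside ∷ p)  zero    rewrite ∪-identityʳ p = n≤1+n _
∣p∪⁅x⁆∣≤1+∣p∣ (outside ∷ p) zero    rewrite ∪-identityʳ p = ≤-refl
∣p∪⁅x⁆∣≤1+∣p∣ (inside ∷ p)  (suc x) = s≤s (∣p∪⁅x⁆∣≤1+∣p∣ p x)
∣p∪⁅x⁆∣≤1+∣p∣ (outside ∷ p) (suc x) = ∣p∪⁅x⁆∣≤1+∣p∣ p x

∣insert∣ : ∀ {n} (p : Subset n) x → x ∉ p → ∣ p [ x ]≔ inside ∣ ≡ suc ∣ p ∣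
∣insert∣ (inside ∷ p)  zero    x∉ = contradiction here x∉
∣insert∣ (outside ∷ p) zero    x∉ = refl
∣insert∣ (inside ∷ p)  (suc x) x∉ = cong suc (∣insert∣ p x (x∉ ∘ there))
∣insert∣ (outside ∷ p) (suc x) x∉ = ∣insert∣ p x (x∉ ∘ there)

∣delete∣ : ∀ {n} (p : Subset n) {x} → x ∈ p → suc ∣ p [ x ]≔ outside ∣ ≡ ∣ p ∣
∣delete∣ (inside ∷ p)  here       = refl
∣delete∣ (inside ∷ p)  (there x∈) = cong suc (∣delete∣ p x∈)
∣delete∣ (outside ∷ p) (there x∈) = ∣delete∣ p x∈

x∈insert : ∀ {n} (p : Subset n) x → x ∈ p [ x ]≔ inside
x∈insert (_ ∷ p) zero    = here
x∈insert (_ ∷ p) (suc x) = there (x∈insert p x)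

∈-insert⁺ : ∀ {n} {p : Subset n} x {y} → y ∈ p → y ∈ p [ x ]≔ inside
∈-insert⁺ zero    here       = here
∈-insert⁺ zero    (there y∈) = there y∈
∈-insert⁺ (suc x) here       = here
∈-insert⁺ (suc x) (there y∈) = there (∈-insert⁺ x y∈)

∈-insert⁻ : ∀ {n} (p : Subset n) x {y} → y ∈ p [ x ]≔ inside → y ≡ x ⊎ y ∈ p
∈-insert⁻ (_ ∷ p) zero    here       = inj₁ refl
∈-insert⁻ (_ ∷ p) zero    (there y∈) = inj₂ (there y∈)
∈-insert⁻ (_ ∷ p) (suc x) here       = inj₂ here
∈-insert⁻ (_ ∷ p) (suc x) (there y∈) with ∈-insert⁻ p x y∈
... | inj₁ refl = inj₁ refl
... | inj₂ q    = inj₂ (there q)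

∈-delete⁺ : ∀ {n} {p : Subset n} x {y} → y ≢ x → y ∈ p → y ∈ p [ x ]≔ outside
∈-delete⁺ zero    y≢x here       = contradiction refl y≢x
∈-delete⁺ zero    y≢x (there y∈) = there y∈
∈-delete⁺ (suc x) y≢x here       = here
∈-delete⁺ (suc x) y≢x (there y∈) = there (∈-delete⁺ x (y≢x ∘ cong suc) y∈)

∈-delete⁻ : ∀ {n} (p : Subset n) x {y} → y ∈ p [ x ]≔ outside → y ∈ p
∈-delete⁻ (_ ∷ p) zero    (there y∈) = there y∈
∈-delete⁻ (_ ∷ p) (suc x) here       = here
∈-delete⁻ (_ ∷ p) (suc x) (there y∈) = there (∈-delete⁻ p x y∈)

insert-∈ : ∀ {n} (p : Subset n) {x} → x ∈ p → p [ x ]≔ inside ≡ p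
insert-∈ (_ ∷ p) here       = refl
insert-∈ (a ∷ p) (there x∈) = cong (a ∷_) (insert-∈ p x∈)

delete-∉ : ∀ {n} (p : Subset n) {x} → x ∉ p → p [ x ]≔ outside ≡ p
delete-∉ (inside ∷ p)  {zero}  x∉ = contradiction here x∉
delete-∉ (outside ∷ p) {zero}  x∉ = refl
delete-∉ (a ∷ p)       {suc x} x∉ = cong (a ∷_) (delete-∉ p (x∉ ∘ there))

swap : ∀ {n} → Fin n → Fin n → Subset n → Subset n
swap y z p = (p [ y ]≔ outside) [ z ]≔ inside

-- This makes the exchange map injective: once `z` is recorded, swapping back recovers the original
-- set.
swap-inverse : ∀ {n} {p : Subset n} {y z} → y ∈ p → z ∉ p → swap z y (swap y z p) ≡ p
swap-inverse {p = p} {y} {z} y∈p z∉p = begin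
  swap z y (swap y z p)
    ≡⟨ cong (_[ y ]≔ inside) ([]≔-idempotent (p [ y ]≔ outside) z) ⟩
  ((p [ y ]≔ outside) [ z ]≔ outside) [ y ]≔ inside
    ≡⟨ cong (_[ y ]≔ inside) (delete-∉ _ (z∉p ∘ ∈-delete⁻ p y)) ⟩
  (p [ y ]≔ outside) [ y ]≔ inside
    ≡⟨ []≔-idempotent p y ⟩
  p [ y ]≔ inside
    ≡⟨ insert-∈ p y∈p ⟩
  p ∎
  where open ≡-Reasoning

∣swap∣ : ∀ {n} {p : Subset n} {y z} → y ∈ p → z ∉ p → ∣ swap y z p ∣ ≡ ∣ p ∣
∣swap∣ {p = p} {y} {z} y∈p z∉p =
  trans (∣insert∣ (p [ y ]≔ outside) z (z∉p ∘ ∈-delete⁻ p y)) (∣delete∣ p y∈p)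

-- Covers of a family

infix 8 _⟨_⟩

_⟨_⟩ : ∀ {n} → List (Subset n) → Subset n → List (Subset n)
F ⟨ X ⟩ = filter (X ⊆?_) F

-- Also known as a transversal or hitting set of `F`.
Covers : ∀ {n} → List (Subset n) → Subset n → Set
Covers F T = All (λ A → Nonempty (A ∩ T)) F

covers? : ∀ {n} (F : List (Subset n)) → Decidable (Covers F)
covers? F T = All.all? (λ A → nonempty? (A ∩ T)) F

minimum-cover : ∀ {n} {F : List (Subset n)} {S} → Covers F S →
  ∃ λ T → Covers F T × (∀ X → Covers F X → ∣ T ∣ ≤ ∣ X ∣)
minimum-cover {n} {F} {S} c =
  -- The given cover `S` is the starting value of `argmin`, so the result is a cover whichever
  -- candidate is chosen.
  argmin ∣_∣ S xs ,
  argmin-all ∣_∣ c (All.all-filter (covers? F) (allSubsets n)) ,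
  λ X cX → All.lookup (f[argmin]≤f[xs] S xs) (∈-filter⁺ (covers? F) (allSubsets-complete X) cX)
  where xs = filter (covers? F) (allSubsets n)

-- A union bound: a member of `F` containing `X` meets `T` in some `y`, hence contains `X ∪ ⁅ y ⁆`.
-- It serves both for the minimum cover and for a member of `F` acting as a cover.
length-⟨⟩-cover : ∀ {n} {F : List (Subset n)} {T} X a b → Unique F → Covers F T →
  (∀ {y} → y ∈ T → length (F ⟨ X ∪ ⁅ y ⁆ ⟩) * a ≤ b) →
  length (F ⟨ X ⟩) * a ≤ ∣ T ∣ * b
length-⟨⟩-cover {F = F} {T} X a b u c h = begin
  length (F ⟨ X ⟩) * a                                  ≤⟨ *-monoˡ-≤ a (length-⊆ (Unique.filter⁺ (X ⊆?_) u) cover) ⟩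
  length (concatMap (λ y → F ⟨ X ∪ ⁅ y ⁆ ⟩) (elements T)) * a
    ≤⟨ length-concatMap-≤ _ a b (elements T) (h ∘ ∈-elements⁻ T) ⟩
  length (elements T) * b                               ≡⟨ cong (_* b) (length-elements T) ⟩
  ∣ T ∣ * b                                             ∎
  where
  open ≤-Reasoning
  cover : ∀ {A} → A LM.∈ F ⟨ X ⟩ → A LM.∈ concatMap (λ y → F ⟨ X ∪ ⁅ y ⁆ ⟩) (elements T)
  cover {A} A∈ with ∈-filter⁻ (X ⊆?_) {xs = F} A∈
  ... | A∈F , X⊆A with All.lookup c A∈F
  ... | y , y∈ with x∈p∩q⁻ A T y∈
  ... | y∈A , y∈T = ∈-concatMap⁺ _ (lose (∈-elements⁺ y∈T) (∈-filter⁺ (X ∪ ⁅ y ⁆ ⊆?_) A∈F X∪y⊆A))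
    where
    X∪y⊆A : X ∪ ⁅ y ⁆ ⊆ A
    X∪y⊆A p with x∈p∪q⁻ X ⁅ y ⁆ p
    ... | inj₁ q = X⊆A q
    ... | inj₂ q rewrite x∈⁅y⁆⇒x≡y y q = y∈A

-- Independent sets

module _ {n : ℕ} (G : Graph n) where

  open DecMembership (Fin._≟_ {n}) using () renaming (_∈?_ to _∈ₗ?_)

  independent? : Decidable (Independent G)
  independent? S = Fin.all? λ i → Fin.all? λ j →
    (i ∈? S) →-dec (j ∈? S) →-dec (adj G i j Bool.≟ false)

  indepOfSize? : ∀ r → Decidable (IndepOfSize G r)
  indepOfSize? r S = independent? S ×-dec (∣ S ∣ ℕ.≟ r)

  indepSets : ℕ → List (Subset n)
  indepSets r = filter (indepOfSize? r) (allSubsets n)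

  indepSets-unique : ∀ r → Unique (indepSets r)
  indepSets-unique r = Unique.filter⁺ (indepOfSize? r) (allSubsets-unique n)

  ∈-indepSets⟨⟩⁺ : ∀ {r X S} → IndepOfSize G r S → X ⊆ S → S LM.∈ indepSets r ⟨ X ⟩
  ∈-indepSets⟨⟩⁺ {r} {X} ind X⊆S =
    ∈-filter⁺ (X ⊆?_) (∈-filter⁺ (indepOfSize? r) (allSubsets-complete _) ind) X⊆S

  ∈-indepSets⟨⟩⁻ : ∀ {r} X {S} → S LM.∈ indepSets r ⟨ X ⟩ → IndepOfSize G r S × X ⊆ S
  ∈-indepSets⟨⟩⁻ {r} X S∈ with ∈-filter⁻ (X ⊆?_) {xs = indepSets r} S∈
  ... | S∈I , X⊆S = proj₂ (∈-filter⁻ (indepOfSize? r) {xs = allSubsets n} S∈I) , X⊆S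

  -- Independence as a Boolean test, and stars

  nonadjacentIn : Subset n → Fin n → Fin n → Bool
  nonadjacentIn S i j = if lookup S i ∧ lookup S j then not (adj G i j) else true

  isIndepContaining⁺ : ∀ {r v S} → v ∈ S → IndepOfSize G r S → isIndepContaining G r v S ≡ true
  isIndepContaining⁺ {r} {v} {S} v∈S (ind , size) = Equivalence.to T-≡
    (Equivalence.from (T-∧ {lookup S v}) (Equivalence.from T-≡ ([]=⇒lookup v∈S) ,
      Equivalence.from (T-∧ {⌊ ∣ S ∣ ℕ.≟ r ⌋}) (fromWitness size ,
        -- `nonadjacentIn` agrees by definition with the test inside `isIndepContaining`.
        All.all⁻ (λ i → all (nonadjacentIn S i) (allFin n)) {allFin n} (All.tabulate λ {i} _ →
          All.all⁻ (nonadjacentIn S i) {allFin n} (All.tabulate λ {j} _ → pair i j)))))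
    where
    pair : ∀ i j → T (nonadjacentIn S i j)
    pair i j with lookup S i in p | lookup S j in q
    ... | false | _     = _
    ... | true  | false = _
    ... | true  | true rewrite ind i j (lookup⇒[]= i S p) (lookup⇒[]= j S q) = _

  isIndepContaining⁻ : ∀ {r v S} → isIndepContaining G r v S ≡ true → v ∈ S × IndepOfSize G r S
  isIndepContaining⁻ {r} {v} {S} e with Equivalence.to (T-∧ {lookup S v}) (Equivalence.from T-≡ e)
  ... | v∈ , rest with Equivalence.to (T-∧ {⌊ ∣ S ∣ ℕ.≟ r ⌋}) rest
  ... | size , ind = lookup⇒[]= v S (Equivalence.to T-≡ v∈) , indep , toWitness size
    where
    indep : Independent G S
    indep i j i∈ j∈ with All.lookup (All.all⁺ (nonadjacentIn S i) (allFin n)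
      (All.lookup (All.all⁺ (λ i → all (nonadjacentIn S i) (allFin n)) (allFin n) ind) (∈-allFin i))) (∈-allFin j)
    ... | p rewrite []=⇒lookup i∈ | []=⇒lookup j∈ with adj G i j
    ... | false = refl

  -- The same filter as in `s`, so that its length is `s G r v` by definition.
  star : ℕ → Fin n → List (Subset n)
  star r v = filter (λ S → isIndepContaining G r v S Bool.≟ true) (allSubsets n)

  star-intersecting : ∀ r v → IntersectingFamily G r (star r v)
  star-intersecting r v =
    Unique.filter⁺ P? (allSubsets-unique n) ,
    proj₂ ∘ member ,
    λ S∈ T∈ → v , x∈p∩q⁺ (proj₁ (member S∈) , proj₁ (member T∈))
    where
    P? = λ S → isIndepContaining G r v S Bool.≟ true
    member : ∀ {S} → S LM.∈ star r v → v ∈ S × IndepOfSize G r S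
    member S∈ = isIndepContaining⁻ (proj₂ (∈-filter⁻ P? {xs = allSubsets n} S∈))

  length-indepSets⟨⟩≤s : ∀ {r X v} → v ∈ X → length (indepSets r ⟨ X ⟩) ≤ s G r v
  length-indepSets⟨⟩≤s {r} {X} {v} v∈X =
    length-⊆ (Unique.filter⁺ (X ⊆?_) (indepSets-unique r)) λ {S} S∈ →
      let ind , X⊆S = ∈-indepSets⟨⟩⁻ X S∈ in
      ∈-filter⁺ (λ S → isIndepContaining G r v S Bool.≟ true) (allSubsets-complete S)
        (isIndepContaining⁺ (X⊆S v∈X) ind)

  -- Free vertices and the exchange argument

  neighbours : Fin n → List (Fin n)
  neighbours w = filter (λ z → adj G w z Bool.≟ true) (allFin n)

  length-neighbours : ∀ w → length (neighbours w) ≤ degree G w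
  length-neighbours w = length-≤-count _ (Unique.filter⁺ (λ z → adj G w z Bool.≟ true) (Unique.allFin⁺ n))
    λ z∈ → Equivalence.from T-≡ (proj₂ (∈-filter⁻ (λ z → adj G w z Bool.≟ true) {xs = allFin n} z∈))

  closedNeighbourhood : Subset n → List (Fin n)
  closedNeighbourhood A = concatMap (λ w → w ∷ neighbours w) (elements A)

  -- Such a vertex can replace any element of an independent `A` without creating an edge.
  free : Subset n → List (Fin n)
  free A = filter (λ z → ¬? (z ∈ₗ? closedNeighbourhood A)) (allFin n)

  ∈-free⁻ : ∀ {A z} → z LM.∈ free A → z ∉ A × (∀ {w} → w ∈ A → adj G w z ≡ false)
  ∈-free⁻ {A} {z} z∈ = z∉A , nonadj
    where
    z∉N : ¬ z LM.∈ closedNeighbourhood A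
    z∉N = proj₂ (∈-filter⁻ (λ z → ¬? (z ∈ₗ? closedNeighbourhood A)) {xs = allFin n} z∈)
    z∉A : z ∉ A
    z∉A z∈A = z∉N (∈-concatMap⁺ _ (lose (∈-elements⁺ z∈A) (here refl)))
    nonadj : ∀ {w} → w ∈ A → adj G w z ≡ false
    nonadj w∈A = ¬-not λ e → z∉N (∈-concatMap⁺ _ (lose (∈-elements⁺ w∈A) (there (∈-filter⁺ _ (∈-allFin z) e))))

  module _ {d : ℕ} (deg : ∀ v → degree G v < d) where

    -- Each vertex of `A` excludes itself and its neighbours, at most `d` vertices together: the
    -- strict bound on the degree pays for the vertex itself.
    length-free : ∀ A → n ≤ length (free A) + ∣ A ∣ * d
    length-free A = begin
      n                                              ≡⟨ length-tabulate {n = n} id ⟨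
      length (allFin n)                              ≤⟨ length-⊆ (Unique.allFin⁺ n) split ⟩
      length (free A ++ closedNeighbourhood A)       ≡⟨ length-++ (free A) ⟩
      length (free A) + length (closedNeighbourhood A)
        ≡⟨ cong (length (free A) +_) (*-identityʳ _) ⟨
      length (free A) + length (closedNeighbourhood A) * 1
        ≤⟨ +-monoʳ-≤ (length (free A)) (length-concatMap-≤ _ 1 d (elements A) λ {w} _ →
             ≤-trans (≤-reflexive (*-identityʳ _)) (≤-trans (s≤s (length-neighbours w)) (deg w))) ⟩
      length (free A) + length (elements A) * d      ≡⟨ cong (λ k → length (free A) + k * d) (length-elements A) ⟩
      length (free A) + ∣ A ∣ * d                    ∎
      where
      open ≤-Reasoning
      split : ∀ {z} → z LM.∈ allFin n → z LM.∈ free A ++ closedNeighbourhood A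
      split {z} z∈ with z ∈ₗ? closedNeighbourhood A
      ... | yes p = ∈-++⁺ʳ (free A) p
      ... | no ¬p = ∈-++⁺ˡ (∈-filter⁺ _ z∈ ¬p)

  swap-indepOfSize : ∀ {r A y z} → IndepOfSize G r A → y ∈ A → z LM.∈ free A →
    IndepOfSize G r (swap y z A)
  swap-indepOfSize {r} {A} {y} {z} (ind , size) y∈A z∈ = indep , trans (∣swap∣ y∈A z∉A) size
    where
    z∉A = proj₁ (∈-free⁻ z∈)
    nonadj = proj₂ (∈-free⁻ z∈)
    member : ∀ {i} → i ∈ swap y z A → i ≡ z ⊎ i ∈ A
    member i∈ with ∈-insert⁻ (A [ y ]≔ outside) z i∈
    ... | inj₁ i≡z = inj₁ i≡z
    ... | inj₂ i∈′ = inj₂ (∈-delete⁻ A y i∈′)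
    indep : Independent G (swap y z A)
    indep i j i∈ j∈ with member i∈ | member j∈
    ... | inj₁ refl | inj₁ refl = irrefl G z
    ... | inj₁ refl | inj₂ q    = trans (Graph.sym G z j) (nonadj q)
    ... | inj₂ p    | inj₁ refl = nonadj p
    ... | inj₂ p    | inj₂ q    = ind i j p q

  -- Counts the pairs (A , z) with z free for A, mapped injectively to (swap y z A , z).
  exchange : ∀ {r c X y} → (∀ A → IndepOfSize G r A → c ≤ length (free A)) → y ∉ X →
    length (indepSets r ⟨ X ∪ ⁅ y ⁆ ⟩) * c ≤ length (indepSets r ⟨ X ⟩) * r
  exchange {r} {c} {X} {y} many y∉X = begin
    length L * c                    ≤⟨ length-concatMap-≥ _ c L (λ {A} A∈ → ≤-trans (many A (proj₁ (mem A∈)))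
                                         (≤-reflexive (sym (length-map _ (free A))))) ⟩
    length (graph free L)           ≤⟨ length-injection f (graph-unique free L-unique free-unique) f∈ f-inj ⟩
    length (graph elements L′)      ≡⟨ *-identityʳ _ ⟨
    length (graph elements L′) * 1  ≤⟨ length-concatMap-≤ _ 1 r L′ (λ {B} B∈ → ≤-reflexive (begin-equality
      length (map (B ,_) (elements B)) * 1  ≡⟨ *-identityʳ _ ⟩
      length (map (B ,_) (elements B))      ≡⟨ length-map _ (elements B) ⟩
      length (elements B)                   ≡⟨ length-elements B ⟩
      ∣ B ∣                                 ≡⟨ proj₂ (proj₁ (∈-indepSets⟨⟩⁻ X B∈)) ⟩
      r                                     ∎)) ⟩
    length L′ * r                   ∎
    where
    open ≤-Reasoning
    L  = indepSets r ⟨ X ∪ ⁅ y ⁆ ⟩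
    L′ = indepSets r ⟨ X ⟩
    L-unique : Unique L
    L-unique = Unique.filter⁺ (X ∪ ⁅ y ⁆ ⊆?_) (indepSets-unique r)
    free-unique : ∀ A → Unique (free A)
    free-unique A = Unique.filter⁺ _ (Unique.allFin⁺ n)
    mem : ∀ {A} → A LM.∈ L → IndepOfSize G r A × (X ∪ ⁅ y ⁆) ⊆ A
    mem = ∈-indepSets⟨⟩⁻ (X ∪ ⁅ y ⁆)
    y∈ : ∀ {A} → A LM.∈ L → y ∈ A
    y∈ A∈ = proj₂ (mem A∈) (q⊆p∪q X ⁅ y ⁆ (x∈⁅x⁆ y))
    f : Subset n × Fin n → Subset n × Fin n
    f (A , z) = swap y z A , z
    f∈ : ∀ {p} → p LM.∈ graph free L → f p LM.∈ graph elements L′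
    f∈ {A , z} p∈ with ∈-graph⁻ free L p∈
    ... | A∈ , z∈ = ∈-graph⁺ elements
      (∈-indepSets⟨⟩⁺ (swap-indepOfSize (proj₁ (mem A∈)) (y∈ A∈) z∈)
        -- As `y` lies outside `X`, removing `y` leaves `X` inside the swapped set.
        λ x∈X → ∈-insert⁺ z (∈-delete⁺ y (λ { refl → y∉X x∈X }) (proj₂ (mem A∈) (p⊆p∪q ⁅ y ⁆ x∈X))))
      (∈-elements⁺ (x∈insert (A [ y ]≔ outside) z))
    f-inj : ∀ {p q} → p LM.∈ graph free L → q LM.∈ graph free L → f p ≡ f q → p ≡ q
    f-inj {A , z} {B , w} p∈ q∈ e = trans (sym (inverse p∈)) (trans (cong f⁻¹ e) (inverse q∈))
      where
      f⁻¹ : Subset n × Fin n → Subset n × Fin n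
      f⁻¹ (A , z) = swap z y A , z
      inverse : ∀ {p} → p LM.∈ graph free L → f⁻¹ (f p) ≡ p
      inverse {C , v} p∈ with ∈-graph⁻ free L p∈
      ... | C∈ , v∈ = cong (_, v) (swap-inverse (y∈ C∈) (proj₁ (∈-free⁻ v∈)))

  -- Descent from large sets to small ones

  module _ {r : ℕ} .{{_ : NonZero r}} {F : List (Subset n)} {t : ℕ}
           (many  : ∀ A → IndepOfSize G r A → r * (2 * r) ≤ length (free A))
           (inter : IntersectingFamily G r F)
           (tight : ∀ X → Covers F X → t ≤ ∣ X ∣) where

    -- By induction on `k`. One step branches over the `r` elements of a missed member and gains
    -- `2 * r` on each branch by `exchange`, a net factor of 2.
    descent : ∀ k X → ∣ X ∣ + k ≤ t → length (F ⟨ X ⟩) * 2 ^ k ≤ length (indepSets r ⟨ X ⟩)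
    descent zero X _ = begin
      length (F ⟨ X ⟩) * 1        ≡⟨ *-identityʳ _ ⟩
      length (F ⟨ X ⟩)            ≤⟨ length-⊆ (Unique.filter⁺ (X ⊆?_) (proj₁ inter)) (λ A∈ →
                                       let A∈F , X⊆A = ∈-filter⁻ (X ⊆?_) {xs = F} A∈ in
                                       ∈-indepSets⟨⟩⁺ (proj₁ (proj₂ inter) A∈F) X⊆A) ⟩
      length (indepSets r ⟨ X ⟩)  ∎
      where open ≤-Reasoning
    descent (suc k) X ∣X∣+k<t
      -- Here `∣ X ∣ < t`, so `X` is not a cover and some member `S` of `F` misses it.
      with find (All.¬All⇒Any¬ (λ A → nonempty? (A ∩ X)) F λ c →
             <⇒≱ (≤-trans (m<m+n ∣ X ∣ (s≤s z≤n)) ∣X∣+k<t) (tight X c))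
    ... | S , S∈F , S∩X=∅ = *-cancelʳ-≤ _ _ r (begin
      length (F ⟨ X ⟩) * 2 ^ suc k * r        ≡⟨ reorder (length (F ⟨ X ⟩)) (2 ^ k) r ⟩
      length (F ⟨ X ⟩) * (2 ^ k * (2 * r))    ≤⟨ length-⟨⟩-cover X _ _ (proj₁ inter) S-covers bound ⟩
      ∣ S ∣ * length (indepSets r ⟨ X ⟩)      ≡⟨ cong (_* length (indepSets r ⟨ X ⟩)) (proj₂ (proj₁ (proj₂ inter) S∈F)) ⟩
      r * length (indepSets r ⟨ X ⟩)          ≡⟨ *-comm r _ ⟩
      length (indepSets r ⟨ X ⟩) * r          ∎)
      where
      open ≤-Reasoning
      reorder : ∀ a b c → a * (2 * b) * c ≡ a * (b * (2 * c))
      reorder = solve-∀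
      S-covers : Covers F S
      S-covers = All.tabulate λ A∈F → proj₂ (proj₂ inter) A∈F S∈F
      bound : ∀ {y} → y ∈ S → length (F ⟨ X ∪ ⁅ y ⁆ ⟩) * (2 ^ k * (2 * r)) ≤ length (indepSets r ⟨ X ⟩)
      bound {y} y∈S = begin
        length (F ⟨ X ∪ ⁅ y ⁆ ⟩) * (2 ^ k * (2 * r))  ≡⟨ *-assoc (length (F ⟨ X ∪ ⁅ y ⁆ ⟩)) (2 ^ k) (2 * r) ⟨
        length (F ⟨ X ∪ ⁅ y ⁆ ⟩) * 2 ^ k * (2 * r)    ≤⟨ *-monoˡ-≤ (2 * r) (descent k (X ∪ ⁅ y ⁆) size) ⟩
        -- `exchange` weighs `r * (2 * r)` free vertices against `r` elements; cancelling one `r`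
        -- leaves `2 * r`.
        length (indepSets r ⟨ X ∪ ⁅ y ⁆ ⟩) * (2 * r)  ≤⟨ *-cancelʳ-≤ _ _ r exchanged ⟩
        length (indepSets r ⟨ X ⟩)                    ∎
        where
        size : ∣ X ∪ ⁅ y ⁆ ∣ + k ≤ t
        size = ≤-trans (+-monoˡ-≤ k (∣p∪⁅x⁆∣≤1+∣p∣ X y)) (≤-trans (≤-reflexive (sym (+-suc ∣ X ∣ k))) ∣X∣+k<t)
        y∉X : y ∉ X
        y∉X y∈X = S∩X=∅ (y , x∈p∩q⁺ (y∈S , y∈X))
        exchanged : length (indepSets r ⟨ X ∪ ⁅ y ⁆ ⟩) * (2 * r) * r ≤ length (indepSets r ⟨ X ⟩) * r
        exchanged = begin
          length (indepSets r ⟨ X ∪ ⁅ y ⁆ ⟩) * (2 * r) * r    ≡⟨ *-assoc (length (indepSets r ⟨ X ∪ ⁅ y ⁆ ⟩)) (2 * r) r ⟩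
          length (indepSets r ⟨ X ∪ ⁅ y ⁆ ⟩) * (2 * r * r)    ≡⟨ cong (length (indepSets r ⟨ X ∪ ⁅ y ⁆ ⟩) *_) (*-comm (2 * r) r) ⟩
          length (indepSets r ⟨ X ∪ ⁅ y ⁆ ⟩) * (r * (2 * r))  ≤⟨ exchange many y∉X ⟩
          length (indepSets r ⟨ X ⟩) * r                      ∎

-- Arithmetic and the conclusion

n<2^n : ∀ n → n < 2 ^ n
n<2^n zero    = s≤s z≤n
n<2^n (suc n) = begin-strict
  suc n          ≤⟨ n<2^n n ⟩
  2 ^ n          <⟨ m<m+n (2 ^ n) (≤-<-trans z≤n (n<2^n n)) ⟩
  2 ^ n + 2 ^ n  ≡⟨ cong (2 ^ n +_) (+-identityʳ (2 ^ n)) ⟨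
  2 ^ suc n      ∎
  where open ≤-Reasoning

intersecting-bound : ∀ {n r m} (G : Graph n) .{{_ : NonZero r}} {F : List (Subset n)} →
  (∀ A → IndepOfSize G r A → r * (2 * r) ≤ length (free G A)) →
  IntersectingFamily G r F → (∀ v → s G r v ≤ m) → length F ≤ m
intersecting-bound G {F = []} _ _ _ = z≤n
intersecting-bound {n} {r} {m} G {F = F@(S ∷ _)} many inter s≤m
  -- In an intersecting family every member is a cover, so the first member `S` can start the
  -- minimisation.
  with minimum-cover {F = F} {S} (All.tabulate λ A∈F → proj₂ (proj₂ inter) A∈F (here refl))
... | T , T-covers , T-min with ∣ T ∣ in ∣T∣≡
-- A cover meets `S` and so cannot be empty.
... | zero = contradiction (length-elements T) λ e → n≮0 (subst (0 <_) (trans e ∣T∣≡) (∈-length (∈-elements⁺ (proj₂ T-nonempty))))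
  where
  T-nonempty : Nonempty T
  T-nonempty with All.lookup T-covers (here refl)
  ... | x , x∈ = x , proj₂ (x∈p∩q⁻ S T x∈)
... | suc k = *-cancelʳ-≤ _ _ (2 ^ k) {{m^n≢0 2 k}} (begin
  -- Every set contains `⊥`, so branching over `T` from `⊥` splits up all of `F`.
  length F * 2 ^ k            ≡⟨ cong (λ L → length L * 2 ^ k) (filter-all (⊥ ⊆?_) (All.universal ⊆-min F)) ⟨
  length (F ⟨ ⊥ ⟩) * 2 ^ k    ≤⟨ length-⟨⟩-cover ⊥ (2 ^ k) m (proj₁ inter) T-covers bound ⟩
  ∣ T ∣ * m                   ≡⟨ cong (_* m) ∣T∣≡ ⟩
  -- `k < 2 ^ k` unfolds to `suc k ≤ 2 ^ k`: the `k` halvings pay for the `suc k` elements of `T`.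
  suc k * m                   ≤⟨ *-monoˡ-≤ m (n<2^n k) ⟩
  2 ^ k * m                   ≡⟨ *-comm (2 ^ k) m ⟩
  m * 2 ^ k                   ∎)
  where
  open ≤-Reasoning
  bound : ∀ {y} → y ∈ T → length (F ⟨ ⊥ ∪ ⁅ y ⁆ ⟩) * 2 ^ k ≤ m
  bound {y} _ = begin
    -- A singleton uses up one of the `suc k` levels, which leaves `k` steps of descent.
    length (F ⟨ ⊥ ∪ ⁅ y ⁆ ⟩) * 2 ^ k          ≤⟨ descent G many inter T-min k (⊥ ∪ ⁅ y ⁆)
                                                   (+-monoˡ-≤ k (subst (λ j → ∣ ⊥ ∪ ⁅ y ⁆ ∣ ≤ suc j) (∣⊥∣≡0 n) (∣p∪⁅x⁆∣≤1+∣p∣ ⊥ y))) ⟩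
    length (indepSets G r ⟨ ⊥ ∪ ⁅ y ⁆ ⟩)      ≤⟨ length-indepSets⟨⟩≤s G (q⊆p∪q ⊥ ⁅ y ⁆ (x∈⁅x⁆ y)) ⟩
    s G r y                                   ≤⟨ s≤m y ⟩
    m                                         ∎

-- With `r` and `d` positive, both `r * r` and `d * r` are at most `d * (r * r)`. Hence
-- `r * (2 * r) + r * d` is at most three times that product, which is 24/8 of it and so within
-- 27/8.
threshold : ∀ {r d} .{{_ : NonZero r}} .{{_ : NonZero d}} {n f} →
  27 * d * r ^ 2 < 8 * n → n ≤ f + r * d → r * (2 * r) ≤ f
threshold {r} {d} {n} {f} h n≤ = +-cancelʳ-≤ (r * d) _ _ (*-cancelˡ-≤ 8 (begin
  8 * (r * (2 * r) + r * d)                  ≡⟨ expand r d ⟩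
  16 * (r * r) + 8 * (d * r)                 ≤⟨ +-mono-≤ (*-monoʳ-≤ 16 (m≤n*m (r * r) d))
                                                         (*-monoʳ-≤ 8 (*-monoʳ-≤ d (m≤m*n r r))) ⟩
  16 * (d * (r * r)) + 8 * (d * (r * r))     ≡⟨ *-distribʳ-+ (d * (r * r)) 16 8 ⟨
  24 * (d * (r * r))                         ≤⟨ *-monoˡ-≤ (d * (r * r)) (m≤m+n 24 3) ⟩
  27 * (d * (r * r))                         ≡⟨ *-assoc 27 d (r * r) ⟨
  -- `r ^ 2` unfolds to `r * (r * 1)`.
  27 * d * (r * r)                           ≡⟨ cong (λ q → 27 * d * (r * q)) (*-identityʳ r) ⟨
  27 * d * r ^ 2                             ≤⟨ <⇒≤ h ⟩
  8 * n                                      ≤⟨ *-monoʳ-≤ 8 n≤ ⟩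
  8 * (f + r * d)                            ∎))
  where
  open ≤-Reasoning
  expand : ∀ r d → 8 * (r * (2 * r) + r * d) ≡ 16 * (r * r) + 8 * (d * r)
  expand = solve-∀

-- The index `suc n` provides `zero` as the starting value of `argmax`.
maximiser : ∀ {n} (f : Fin (suc n) → ℕ) → ∃ λ v → ∀ x → f x ≤ f v
maximiser {n} f = argmax f zero xs , λ x → All.lookup (f[xs]≤f[argmax] {f = f} zero xs) (∈-allFin x)
  where xs = allFin (suc n)

theorem2p1 : (r d n : ℕ) → 0 < r → 0 < d → (G : Graph n)
    → 27 * d * r ^ 2 < 8 * n
    → (∀ (v : Fin n) → degree G v < d)
    → EKR G r
-- Without vertices the bound would place a number below zero.
theorem2p1 r d zero    _   _   _ h = contradiction h (n≮0 {27 * d * r ^ 2})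
theorem2p1 r d (suc n) 0<r 0<d G h deg F inter F-max =
  -- The star of `v` competes with the maximum family `F`; conversely `intersecting-bound` applies
  -- with `m` equal to the largest star size.
  v , ≤-antisym (F-max (star G r v) (star-intersecting G r v))
                (intersecting-bound G {{>-nonZero 0<r}} many inter (proj₂ (maximiser (s G r))))
  where
  v : Fin (suc n)
  v = proj₁ (maximiser (s G r))
  many : ∀ A → IndepOfSize G r A → r * (2 * r) ≤ length (free G A)
  many A (_ , size) = threshold {r} {d} {{>-nonZero 0<r}} {{>-nonZero 0<d}} {suc n} {length (free G A)} h
    (subst (λ k → suc n ≤ length (free G A) + k * d) size (length-free G deg A))
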